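{- Let $n\ge 2$ and let $k$ be a positive integer with $\gcd(k,n)=1$ and $k\equiv\pm1\pmod n$. Then $\Delta=H_0$, and for every pair of distinct nonzero $v_1,v_2\in\mathbb{F}_{2^n}$, $$\bigl|\{(x,y,z)\in\Delta^3:\ v_1x+v_2y+(v_1+v_2)z=0\}\bigr|=2^{2n-3}.$$
   Context: $\mathbb{F}_{2^n}$ is the field with $2^n$ elements, $\operatorname{Tr}(x)=\sum_{i=0}^{n-1}x^{2^i}$ is the absolute trace, and $H_0=\{x\in\mathbb{F}_{2^n}:\operatorname{Tr}(x)=0\}$. Put $F(x)=x^{4^k-2^k+1}$ for $x\in\mathbb{F}_{2^n}$, $\delta(b)=F(b)+F(b+1)+1$, and $\Delta=\{\delta(b): b\in\mathbb{F}_{2^n}\}$. -}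

module Defs where

open import Algebra.Bundles using (CommutativeRing)
import Algebra.Properties.Monoid.Sum as Sum
import Algebra.Properties.Semiring.Exp as Exp
open import Data.Fin.Base using (toℕ)
open import Data.Fin.Properties using (≡-setoid)
open import Data.Integer.Base as ℤ using (ℤ)
open import Data.Integer.Divisibility using (_∣_)
open import Data.Nat.Base as ℕ using (ℕ)
open import Data.Product.Base using (Σ; ∃-syntax; _×_; _,_; proj₁)
open import Data.Product.Relation.Binary.Pointwise.NonDependent using (×-setoid)
open import Function.Bundles using (Inverse)
open import Level using (Level; suc; _⊔_)
open import Relation.Binary.Bundles using (Setoid)
import Relation.Binary.Construct.On as On
open import Relation.Nullary.Negation.Core using (¬_)
open import Relation.Unary using (Pred)

-- The library's only field structure is the Heyting field, which carries an
-- apartness relation. A finite field has decidable equality, so apartness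
-- is just inequality and the classical definition is used instead.
record Field (c ℓ : Level) : Set (suc (c ⊔ ℓ)) where
  field
    commutativeRing : CommutativeRing c ℓ

  open CommutativeRing commutativeRing public

  field
    0≉1     : ¬ (0# ≈ 1#)
    inverse : ∀ x → ¬ (x ≈ 0#) → ∃[ y ] (x * y ≈ 1#)

HasCardinality : ∀ {a ℓ} → Setoid a ℓ → ℕ → Set (a ⊔ ℓ)
HasCardinality S m = Inverse (≡-setoid m) S

-- Elements are compared through their first component only, so an element
-- is counted once however many proofs of membership it has.
subsetSetoid : ∀ {a ℓ p} (S : Setoid a ℓ) → Pred (Setoid.Carrier S) p →
               Setoid (a ⊔ p) ℓ
subsetSetoid S P = record
  { Carrier       = Σ (Setoid.Carrier S) P
  ; _≈_           = λ s t → Setoid._≈_ S (proj₁ s) (proj₁ t)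
  ; isEquivalence = On.isEquivalence proj₁ (Setoid.isEquivalence S)
  }

infix 4 _≡_[mod_]

_≡_[mod_] : ℤ → ℤ → ℕ → Set
a ≡ b [mod n ] = ℤ.+ n ∣ (a ℤ.- b)

-- Meaningful when K has 2ⁿ elements.
module Kasami {c ℓ} (K : Field c ℓ) (n k : ℕ) where

  open Field K
  open Exp semiring using (_^_)
  open Sum +-monoid using (sum-syntax)

  Tr : Carrier → Carrier
  Tr x = ∑[ i < n ] (x ^ (2 ℕ.^ toℕ i))

  H₀ : Pred Carrier ℓ
  H₀ x = Tr x ≈ 0#

  -- The truncated subtraction is exact, since 2ᵏ ≤ 4ᵏ.
  F : Carrier → Carrier
  F x = x ^ (4 ℕ.^ k ℕ.∸ 2 ℕ.^ k ℕ.+ 1)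

  δ : Carrier → Carrier
  δ b = F b + F (b + 1#) + 1#

  Δ : Pred Carrier (c ⊔ ℓ)
  Δ x = ∃[ b ] (x ≈ δ b)

  tripleSetoid : Setoid c ℓ
  tripleSetoid = ×-setoid setoid (×-setoid setoid setoid)

  Solutions : Carrier → Carrier → Pred (Carrier × Carrier × Carrier) (c ⊔ ℓ)
  Solutions v₁ v₂ (x , y , z) =
    (Δ x × Δ y × Δ z) × v₁ * x + v₂ * y + (v₁ + v₂) * z ≈ 0#

{-# OPTIONS --safe #-}

-- For k ≡ ±1 (mod n) there is an additive bijection ψ of K fixing 1 with F = ψ³: the
-- identity for k ≡ 1, and x ↦ x^(4ᵏ) (the inverse of x ↦ x⁴) for k ≡ −1. Hence
-- δ(b) = ψ(b)³ + (ψ(b) + 1)³ + 1 = ψ(b)² + ψ(b), and Δ is the image of b ↦ b² + b, which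
-- is H₀ by additive Hilbert 90. With a = v₂/v₁ ∉ {0, 1}, a solution is determined by
-- z ∈ H₀ and u = y + z ∈ H₀, subject only to x + z = a u ∈ H₀. The traces of u and of a u
-- are independent functionals of u, so there are 2ⁿ⁻¹ choices of z and 2ⁿ⁻² of u.

module Submission where

open import Defs
open import Algebra.Bundles using (CommutativeMonoid; CommutativeRing; CommutativeSemiring)
import Algebra.Properties.CommutativeMonoid.Sum as CommutativeMonoidSum
import Algebra.Properties.CommutativeSemiring.Exp as CommutativeSemiringExp
import Algebra.Properties.Group as GroupProperties
import Algebra.Properties.Monoid.Sum as MonoidSum
import Algebra.Properties.Ring as RingProperties
import Algebra.Properties.Semiring.Mult as SemiringMult
import Algebra.Solver.Ring as RingSolver
import Algebra.Solver.Ring.AlmostCommutativeRing as ACR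
import Algebra.Solver.Ring.NaturalCoefficients.Default as NatSolver
open import Data.Bool.Base using (Bool; true; false)
open import Data.Bool.Properties using (xor-∧-commutativeRing)
open import Data.Empty using (⊥-elim)
open import Data.Fin.Base as Fin using (Fin; toℕ)
import Data.Fin.Permutation as Perm
open import Data.Fin.Properties using (*↔×; ¬∀⟶∃¬; ≡-setoid; punchInᵢ≢i)
  renaming (_≟_ to _≟ᶠ_; suc-injective to sucᶠ-injective)
open import Data.Integer.Base using (+_; 1ℤ; -1ℤ)
open import Data.List.Base using (List; allFin; filter; length; lookup)
open import Data.List.Membership.Propositional.Properties
  using (∈-allFin; ∈-filter⁺; ∈-filter⁻; ∈-lookup)
import Data.List.Relation.Unary.All as All
open import Data.List.Relation.Unary.AllPairs using ([]; _∷_)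
open import Data.List.Relation.Unary.Any using (index)
open import Data.List.Relation.Unary.Any.Properties using (lookup-index)
open import Data.List.Relation.Unary.Unique.Propositional using (Unique)
open import Data.List.Relation.Unary.Unique.Propositional.Properties using (allFin⁺; filter⁺)
open import Data.Maybe.Base using (Maybe; just; nothing)
open import Data.Nat.Base as ℕ using (ℕ; zero; suc; z≤n; s≤s)
open import Data.Nat.Divisibility using (divides)
open import Data.Nat.GCD using (gcd)
import Data.Nat.Properties as ℕ
open import Data.Product.Base using (Σ; ∃-syntax; _×_; _,_; proj₁; proj₂)
open import Data.Product.Function.NonDependent.Setoid using (_×-inverse_)
open import Data.Product.Relation.Binary.Pointwise.NonDependent using (Pointwise-≡↔≡; ×-setoid)
open import Data.Sum.Base using (_⊎_; inj₁; inj₂)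
open import Data.Vec.Functional using (Vector; removeAt; replicate)
open import Function.Base using (_∘_)
open import Function.Bundles using (Func; Inverse)
import Function.Construct.Composition as Compose
import Function.Construct.Identity as Identity
import Function.Construct.Symmetry as Symmetry
import Function.Consequences.Setoid as Consequences
open import Function.Definitions using (Injective)
open import Function.Properties.Bijection using (Bijection⇒Inverse)
open import Level using (_⊔_)
open import Relation.Binary.Bundles using (Setoid)
open import Relation.Binary.Definitions using (_Respects_) renaming (Decidable to Decidable₂)
open import Relation.Binary.PropositionalEquality as ≡ using (_≡_)
import Relation.Binary.Reasoning.Setoid as SetoidReasoning
open import Relation.Nullary.Decidable using (Dec; yes; no; map′; _×-dec_)
open import Relation.Nullary.Negation.Core using (¬_; contradiction)
open import Relation.Unary using (Pred; Decidable; U; _∩_; _⊆_; _≐_)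

-- Beyond the field axioms only an enumeration of K by 2ⁿ indices is given, so its arithmetic is
-- recovered by counting: a sum over all of K gives characteristic two, a product gives x^(2ⁿ) = x,
-- and an element of trace 1 exists because a nonzero polynomial of degree 2ⁿ⁻¹ cannot have 2ⁿ
-- roots. Subspaces are counted without bases. A subset closed under addition splits into two cosets
-- of the kernel of a trace functional as soon as it contains an element of value 1. Independence of
-- Tr(u) and Tr(a u) thus reduces to one u with Tr(u) = 0 and Tr(a u) = 1, which comes from Tr(a(b²
-- + b)) = Tr((a² + a)b²). The identity F = ψ³ is reached through F(x) x^(2ᵏ) = x^(4ᵏ) x, which
-- involves no subtraction of exponents; the price is a separate case at 0.

-- Cardinalities of setoids and of their decidable subsets.

module _ {a₁ ℓ₁ a₂ ℓ₂} {S : Setoid a₁ ℓ₁} {T : Setoid a₂ ℓ₂} where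
  private
    module S = Setoid S
    module T = Setoid T

  injection+section⇒inverse : (f : Func S T) → Injective S._≈_ T._≈_ (Func.to f) →
    (∀ y → ∃[ x ] Func.to f x T.≈ y) → Inverse S T
  injection+section⇒inverse f injective section = Bijection⇒Inverse record
    { to        = Func.to f
    ; cong      = Func.cong f
    ; bijective = injective ,
        Consequences.strictlySurjective⇒surjective S T (Func.cong f) section
    }

  HasCardinality-respects : ∀ {m} → Inverse S T → HasCardinality S m → HasCardinality T m
  HasCardinality-respects i e = Compose.inverse e i

  HasCardinality-× : ∀ {m n} → HasCardinality S m → HasCardinality T n →
    HasCardinality (×-setoid S T) (m ℕ.* n)
  HasCardinality-× {m} d e = Compose.inverse (*↔× {m})
    (Compose.inverse (Symmetry.inverse Pointwise-≡↔≡) (d ×-inverse e))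

module _ {a ℓ} {S : Setoid a ℓ} where
  open Setoid S

  HasCardinality-unique : ∀ {m n} → HasCardinality S m → HasCardinality S n → m ≡ n
  HasCardinality-unique d e = Perm.↔⇒≡ (Compose.inverse d (Symmetry.inverse e))

  HasCardinality⇒≈-dec : ∀ {m} → HasCardinality S m → Decidable₂ _≈_
  HasCardinality⇒≈-dec e x y = map′
    (λ p → trans (sym (strictlyInverseˡ x)) (trans (to-cong p) (strictlyInverseˡ y)))
    from-cong (from x ≟ᶠ from y)
    where open Inverse e

  subset-≐ : ∀ {p q} {P : Pred Carrier p} {Q : Pred Carrier q} → P ≐ Q →
    Inverse (subsetSetoid S P) (subsetSetoid S Q)
  subset-≐ (P⊆Q , Q⊆P) = record
    { to        = λ (x , px) → x , P⊆Q px
    ; from      = λ (x , qx) → x , Q⊆P qx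
    ; to-cong   = λ x≈y → x≈y
    ; from-cong = λ x≈y → x≈y
    ; inverse   = (λ x≈y → x≈y) , (λ x≈y → x≈y)
    }

  subset-U : Inverse S (subsetSetoid S U)
  subset-U = record
    { to        = λ x → x , _
    ; from      = proj₁
    ; to-cong   = λ x≈y → x≈y
    ; from-cong = λ x≈y → x≈y
    ; inverse   = (λ x≈y → x≈y) , (λ x≈y → x≈y)
    }

Unique⇒lookup-injective : ∀ {a} {A : Set a} {xs : List A} → Unique xs →
  Injective _≡_ _≡_ (lookup xs)
Unique⇒lookup-injective (_ ∷ _)   {Fin.zero}  {Fin.zero}  _ = ≡.refl
Unique⇒lookup-injective (x∉ ∷ _)  {Fin.zero}  {Fin.suc j} p =
  contradiction p (All.lookup x∉ (∈-lookup j))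
Unique⇒lookup-injective (x∉ ∷ _)  {Fin.suc i} {Fin.zero}  p =
  contradiction (≡.sym p) (All.lookup x∉ (∈-lookup i))
Unique⇒lookup-injective (_ ∷ xs!) {Fin.suc i} {Fin.suc j} p =
  ≡.cong Fin.suc (Unique⇒lookup-injective xs! p)

-- The size is merely shown to exist, as the length of a filtered list of indices;
-- `HasCardinality-halve` identifies it afterwards by comparison with a known count.
decidable-subset-finite : ∀ {a ℓ p N} {S : Setoid a ℓ} {P : Pred (Setoid.Carrier S) p} →
  HasCardinality S N → Decidable P → P Respects Setoid._≈_ S →
  ∃[ m ] HasCardinality (subsetSetoid S P) m
decidable-subset-finite {N = N} {S} {P} e P? resp =
  length xs , injection+section⇒inverse
    (record { to = element ; cong = λ { ≡.refl → refl } })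
    (λ p → Unique⇒lookup-injective (filter⁺ P∘to? (allFin⁺ N)) (to-injective p))
    -- The enumeration returns x only up to `≈`, so membership has to be transported to its
    -- representative before its index can be looked up.
    (λ (x , px) →
      let i∈ = ∈-filter⁺ P∘to? (∈-allFin (from x)) (resp (sym (strictlyInverseˡ x)) px)
      in index i∈ , trans (to-cong (≡.sym (lookup-index i∈))) (strictlyInverseˡ x))
  where
  open Setoid S
  open Inverse e
  P∘to? : Decidable (P ∘ to)
  P∘to? i = P? (to i)
  xs : List (Fin N)
  xs = filter P∘to? (allFin N)
  element : Fin (length xs) → Σ Carrier P
  element i = to (lookup xs i) , proj₂ (∈-filter⁻ P∘to? {xs = allFin N} (∈-lookup i))
  to-injective : Injective _≡_ _≈_ to
  to-injective {i} {j} p =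
    ≡.trans (≡.sym (strictlyInverseʳ i)) (≡.trans (from-cong p) (strictlyInverseʳ j))

-- Conjugation by the enumeration turns π into a permutation of the indices. The monoid is left
-- general because both sums and products over K are reindexed.
sum-reindex : ∀ {c ℓ a ℓ′ m} (M : CommutativeMonoid c ℓ) {S : Setoid a ℓ′} →
  let open CommutativeMonoid M; open CommutativeMonoidSum M using (sum) in
  (e : HasCardinality S m) (π : Inverse S S) (f : Func S setoid) →
  sum (Func.to f ∘ Inverse.to e) ≈ sum (Func.to f ∘ Inverse.to π ∘ Inverse.to e)
sum-reindex {m = m} M e π f = trans
  (sum-permute (Func.to f ∘ Inverse.to e) (Compose.inverse (Compose.inverse e π) (Symmetry.inverse e)))
  (sum-cong-≋ {m} λ i → Func.cong f (Inverse.strictlyInverseˡ e _))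
  where
  open CommutativeMonoid M
  open CommutativeMonoidSum M

-- Monic polynomial functions and the bound on their roots.

module MonicPolynomials {c ℓ} (R : CommutativeSemiring c ℓ) where
  open CommutativeSemiring R
  open CommutativeSemiringExp R
  open NatSolver R using (solve; _:+_; _:*_; _:=_; con)

  -- Horner form, read as a property of functions. The degree is an index and not an invariant of
  -- the function: over a field of q elements, x^q and x agree everywhere. The root bound holds for
  -- each degree that can be derived.
  data Monic : ℕ → (Carrier → Carrier) → Set (c ⊔ ℓ) where
    one  : ∀ {f} → (∀ x → f x ≈ 1#) → Monic 0 f
    step : ∀ {d f g} a → Monic d g → (∀ x → f x ≈ a + x * g x) → Monic (suc d) f

  Monic-resp-≈ : ∀ {d f g} → (∀ x → f x ≈ g x) → Monic d f → Monic d g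
  Monic-resp-≈ f≈g (one f≈1)       = one λ x → trans (sym (f≈g x)) (f≈1 x)
  Monic-resp-≈ f≈g (step a h f≈)   = step a h λ x → trans (sym (f≈g x)) (f≈ x)

  Monic-^ : ∀ d → Monic d (_^ d)
  Monic-^ zero    = one λ _ → refl
  Monic-^ (suc d) = step 0# (Monic-^ d) λ x → sym (+-identityˡ _)

  Monic-+^ : ∀ {d e f} → Monic d f → e ℕ.< d → Monic d (λ x → f x + x ^ e)
  Monic-+^ {e = zero} (step {g = g} a mg f≈) _ = step (a + 1#) mg λ x →
    trans (+-congʳ (f≈ x))
      (solve 3 (λ a x g → a :+ x :* g :+ con 1 := a :+ con 1 :+ x :* g) refl a x (g x))
  Monic-+^ {e = suc e} (step {g = g} a mg f≈) (s≤s e<d) = step a (Monic-+^ mg e<d) λ x →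
    trans (+-congʳ (f≈ x))
      (solve 4 (λ a x g y → a :+ x :* g :+ x :* y := a :+ x :* (g :+ y)) refl a x (g x) (x ^ e))

  -- Division by x − a, with both sides moved so that no subtraction occurs.
  Monic-divide : ∀ {d f} → Monic (suc d) f → ∀ a →
    ∃[ g ] Monic d g × (∀ x → f x + a * g x ≈ x * g x + f a)
  Monic-divide (step {g = g} c (one g≈1) f≈) a = (λ _ → 1#) , one (λ _ → refl) , λ x → begin
    _ + a * 1#                 ≈⟨ +-congʳ (trans (f≈ x) (+-congˡ (*-congˡ (g≈1 x)))) ⟩
    c + x * 1# + a * 1#        ≈⟨ solve 3 (λ c x a → c :+ x :* con 1 :+ a :* con 1
                                    := x :* con 1 :+ (c :+ a :* con 1)) refl c x a ⟩
    x * 1# + (c + a * 1#)      ≈⟨ +-congˡ (trans (f≈ a) (+-congˡ (*-congˡ (g≈1 a)))) ⟨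
    x * 1# + _                 ∎
    where open SetoidReasoning setoid
  Monic-divide (step {g = g} c mg@(step _ _ _) f≈) a with Monic-divide mg a
  -- With h the quotient of g, f(x) - f(a) = x g(x) - a g(a) = (x - a) g(a) + x (g(x) - g(a)), so
  -- the quotient of f is g(a) + x h(x).
  ... | h , mh , eq = (λ x → g a + x * h x) , step (g a) mh (λ _ → refl) , λ x → begin
    _ + a * (g a + x * h x)               ≈⟨ +-congʳ (f≈ x) ⟩
    c + x * g x + a * (g a + x * h x)     ≈⟨ solve 6 (λ c x gx a ga hx →
                                               c :+ x :* gx :+ a :* (ga :+ x :* hx)
                                               := c :+ a :* ga :+ x :* (gx :+ a :* hx))
                                               refl c x (g x) a (g a) (h x) ⟩
    c + a * g a + x * (g x + a * h x)     ≈⟨ +-congˡ (*-congˡ (eq x)) ⟩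
    c + a * g a + x * (x * h x + g a)     ≈⟨ solve 5 (λ c x a ga hx →
                                               c :+ a :* ga :+ x :* (x :* hx :+ ga)
                                               := x :* (ga :+ x :* hx) :+ (c :+ a :* ga))
                                               refl c x a (g a) (h x) ⟩
    x * (g a + x * h x) + (c + a * g a)   ≈⟨ +-congˡ (f≈ a) ⟨
    x * (g a + x * h x) + _               ∎
    where open SetoidReasoning setoid

module FieldProperties {c ℓ} (K : Field c ℓ) where
  open Field K
  open MonicPolynomials commutativeSemiring
  open CommutativeSemiringExp commutativeSemiring
  open SetoidReasoning setoid

  x*y≈0∧x≉0⇒y≈0 : ∀ {x y} → x * y ≈ 0# → ¬ (x ≈ 0#) → y ≈ 0#
  x*y≈0∧x≉0⇒y≈0 {x} {y} xy≈0 x≉0 with w , xw≈1 ← inverse x x≉0 = begin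
    y           ≈⟨ *-identityˡ y ⟨
    1# * y      ≈⟨ *-congʳ (trans (*-comm w x) xw≈1) ⟨
    w * x * y   ≈⟨ *-assoc w x y ⟩
    w * (x * y) ≈⟨ *-congˡ xy≈0 ⟩
    w * 0#      ≈⟨ zeroʳ w ⟩
    0#          ∎

  *-cancelʳ-nonZero : ∀ {x y z} → ¬ (z ≈ 0#) → x * z ≈ y * z → x ≈ y
  *-cancelʳ-nonZero {x} {y} {z} z≉0 xz≈yz with w , zw≈1 ← inverse z z≉0 = begin
    x           ≈⟨ x*z*w≈x x ⟨
    x * z * w   ≈⟨ *-congʳ xz≈yz ⟩
    y * z * w   ≈⟨ x*z*w≈x y ⟩
    y           ∎
    where
    x*z*w≈x : ∀ x → x * z * w ≈ x
    x*z*w≈x x = trans (*-assoc x z w) (trans (*-congˡ zw≈1) (*-identityʳ x))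

  -- Dividing out one root lowers the degree by one. Each remaining root differs from it, so the
  -- factor a - x cancels and the root passes to the quotient.
  roots≤degree : ∀ {m d f} → Monic d f → (r : Fin m → Carrier) → Injective _≡_ _≈_ r →
    (∀ i → f (r i) ≈ 0#) → m ℕ.≤ d
  roots≤degree {zero}  _         r r-inj root = z≤n
  roots≤degree {suc m} (one f≈1) r r-inj root =
    contradiction (trans (sym (root Fin.zero)) (f≈1 _)) 0≉1
  roots≤degree {suc m} mf@(step _ _ _) r r-inj root with Monic-divide mf (r Fin.zero)
  ... | g , mg , eq = s≤s (roots≤degree mg (r ∘ Fin.suc) (sucᶠ-injective ∘ r-inj) root′)
    where
    open GroupProperties +-group using (x∙y⁻¹≈ε⇒x≈y; x≈y⇒x∙y⁻¹≈ε)
    open RingProperties ring using ([y-z]x≈yx-zx)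
    a = r Fin.zero
    root′ : ∀ i → g (r (Fin.suc i)) ≈ 0#
    root′ i = x*y≈0∧x≉0⇒y≈0 {a - x}
      (trans ([y-z]x≈yx-zx _ _ _) (x≈y⇒x∙y⁻¹≈ε (begin
        a * g x          ≈⟨ +-identityˡ _ ⟨
        0# + a * g x     ≈⟨ +-congʳ (root (Fin.suc i)) ⟨
        _ + a * g x      ≈⟨ eq x ⟩
        x * g x + _      ≈⟨ +-congˡ (root Fin.zero) ⟩
        x * g x + 0#     ≈⟨ +-identityʳ _ ⟩
        x * g x          ∎)))
      (λ a-x≈0 → contradiction (r-inj (x∙y⁻¹≈ε⇒x≈y _ _ a-x≈0)) λ ())
      where x = r (Fin.suc i)

-- Finite fields: the characteristic and x^N = x.

module FiniteField {c ℓ} (K : Field c ℓ) {N} (e : HasCardinality (Field.setoid K) N) where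
  open Field K
  open FieldProperties K
  open CommutativeSemiringExp commutativeSemiring
  open SemiringMult semiring using (×1-homo-*) renaming (_×_ to _⋆_)
  open GroupProperties +-group using (∙-cancelˡ)
  open SetoidReasoning setoid
  open Inverse e using () renaming (to to element; from to position;
    from-cong to position-cong; strictlyInverseˡ to element-position)
  private
    module ∑ = CommutativeMonoidSum +-commutativeMonoid
    module ∏ = CommutativeMonoidSum *-commutativeMonoid

  infix 4 _≈?_
  _≈?_ : Decidable₂ _≈_
  _≈?_ = HasCardinality⇒≈-dec e

  -- Translation by 1 permutes the field, so summing all elements gives N ⋆ 1 ≈ 0.
  cardinality⋆1≈0 : N ⋆ 1# ≈ 0#
  cardinality⋆1≈0 = sym (∙-cancelˡ (∑.sum element) 0# (N ⋆ 1#) (begin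
    ∑.sum element + 0#                          ≈⟨ +-identityʳ _ ⟩
    ∑.sum element                               ≈⟨ sum-reindex +-commutativeMonoid e translation
                                                     record { to = λ x → x ; cong = λ p → p } ⟩
    ∑.sum (λ i → element i + 1#)                ≈⟨ ∑.∑-distrib-+ element (replicate N 1#) ⟩
    ∑.sum element + ∑.sum (replicate N 1#)      ≈⟨ +-congˡ (∑.sum-replicate N) ⟩
    ∑.sum element + N ⋆ 1#                      ∎))
    where
    translation : Inverse setoid setoid
    translation = injection+section⇒inverse
      (record { to = _+ 1# ; cong = +-congʳ })
      (GroupProperties.∙-cancelʳ +-group 1# _ _)
      (λ y → y - 1# , trans (+-assoc _ _ _) (trans (+-congˡ (-‿inverseˡ 1#)) (+-identityʳ y)))

  -- 2ⁿ ⋆ 1 is the n-th power of 1 + 1, and a field has no zero divisors.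
  2^n⋆1≈0⇒1+1≈0 : ∀ n → (2 ℕ.^ n) ⋆ 1# ≈ 0# → 1# + 1# ≈ 0#
  2^n⋆1≈0⇒1+1≈0 zero    p = contradiction (trans (sym p) (+-identityʳ 1#)) 0≉1
  2^n⋆1≈0⇒1+1≈0 (suc n) p with 1# + 1# ≈? 0#
  ... | yes 2≈0 = 2≈0
  ... | no  2≉0 = 2^n⋆1≈0⇒1+1≈0 n (x*y≈0∧x≉0⇒y≈0
    (trans (sym (×1-homo-* 2 (2 ℕ.^ n))) p)
    (2≉0 ∘ trans (+-congˡ (sym (+-identityʳ 1#)))))

  private
    onZero : ∀ {x} → Dec (x ≈ 0#) → Carrier → Carrier → Carrier
    onZero (yes _) u v = u
    onZero (no  _) u v = v

    nonZeroOr1 : Carrier → Carrier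
    nonZeroOr1 x = onZero (x ≈? 0#) 1# x

    nonZeroOr1-cong : ∀ {x y} → x ≈ y → nonZeroOr1 x ≈ nonZeroOr1 y
    nonZeroOr1-cong {x} {y} x≈y with x ≈? 0# | y ≈? 0#
    ... | yes _   | yes _   = refl
    ... | yes x≈0 | no  y≉0 = contradiction (trans (sym x≈y) x≈0) y≉0
    ... | no  x≉0 | yes y≈0 = contradiction (trans x≈y y≈0) x≉0
    ... | no  _   | no  _   = x≈y

    nonZeroOr1≉0 : ∀ x → ¬ (nonZeroOr1 x ≈ 0#)
    nonZeroOr1≉0 x with x ≈? 0#
    ... | yes _   = 0≉1 ∘ sym
    ... | no  x≉0 = x≉0

    ∏≉0 : ∀ {m} (t : Vector Carrier m) → (∀ i → ¬ (t i ≈ 0#)) → ¬ (∏.sum t ≈ 0#)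
    ∏≉0 {zero}  t t≉0 p = 0≉1 (sym p)
    ∏≉0 {suc m} t t≉0 p = ∏≉0 (t ∘ Fin.suc) (t≉0 ∘ Fin.suc) (x*y≈0∧x≉0⇒y≈0 p (t≉0 Fin.zero))

  -- Multiplication by a permutes the nonzero elements. Their product is taken over all
  -- of K with 0 replaced by 1; the factor picked up is a, except at 0 where it is 1.
  module _ (a : Carrier) (a≉0 : ¬ (a ≈ 0#)) where
    private
      factor : Carrier → Carrier
      factor x = onZero (x ≈? 0#) 1# a

      nonZeroOr1-scale : ∀ x → nonZeroOr1 (a * x) ≈ factor x * nonZeroOr1 x
      nonZeroOr1-scale x with x ≈? 0# | a * x ≈? 0#
      ... | yes _   | yes _    = sym (*-identityˡ 1#)
      ... | yes x≈0 | no  ax≉0 = contradiction (trans (*-congˡ x≈0) (zeroʳ a)) ax≉0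
      ... | no  x≉0 | yes ax≈0 = contradiction (x*y≈0∧x≉0⇒y≈0 ax≈0 a≉0) x≉0
      ... | no  _   | no  _    = refl

      scaling : Inverse setoid setoid
      scaling = injection+section⇒inverse
        (record { to = a *_ ; cong = *-congˡ })
        (λ p → *-cancelʳ-nonZero a≉0 (trans (*-comm _ a) (trans p (*-comm a _))))
        (λ y → let w , aw≈1 = inverse a a≉0 in
          w * y , trans (sym (*-assoc a w y)) (trans (*-congʳ aw≈1) (*-identityˡ y)))

    -- The product of `nonZeroOr1` is unchanged under x ↦ a x and is itself nonzero, so it cancels
    -- and leaves the product of the factors picked up.
    ∏factor≈1 : ∏.sum (factor ∘ element) ≈ 1#
    ∏factor≈1 = sym (*-cancelʳ-nonZero (∏≉0 (nonZeroOr1 ∘ element) (nonZeroOr1≉0 ∘ element)) (begin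
      1# * ∏.sum (nonZeroOr1 ∘ element)              ≈⟨ *-identityˡ _ ⟩
      ∏.sum (nonZeroOr1 ∘ element)                   ≈⟨ sum-reindex *-commutativeMonoid e scaling
                                                          record { to = nonZeroOr1 ; cong = nonZeroOr1-cong } ⟩
      ∏.sum (λ i → nonZeroOr1 (a * element i))       ≈⟨ ∏.sum-cong-≋ {N} (nonZeroOr1-scale ∘ element) ⟩
      ∏.sum (λ i → factor (element i) * nonZeroOr1 (element i))
        ≈⟨ ∏.∑-distrib-+ (factor ∘ element) (nonZeroOr1 ∘ element) ⟩
      ∏.sum (factor ∘ element) * ∏.sum (nonZeroOr1 ∘ element) ∎))

    factor≈1 : ∀ {x} → x ≈ 0# → factor x ≈ 1#
    factor≈1 {x} x≈0 with x ≈? 0#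
    ... | yes _   = refl
    ... | no  x≉0 = contradiction x≈0 x≉0

    factor≈a : ∀ {x} → ¬ (x ≈ 0#) → factor x ≈ a
    factor≈a {x} x≉0 with x ≈? 0#
    ... | yes x≈0 = contradiction x≈0 x≉0
    ... | no  _   = refl

    -- Taking out the index of 0, whose factor is 1, leaves N - 1 factors equal to a. Hence a^(N-1)
    -- = 1, and one more factor a gives the claim.
    nonZero-^cardinality : ∀ {N′} → N ≡ suc N′ → a ^ N ≈ a
    nonZero-^cardinality {N′} ≡.refl = begin
      a * a ^ N′                                        ≈⟨ *-congˡ (∏.sum-replicate N′) ⟨
      a * ∏.sum (replicate N′ a)                        ≈⟨ *-congˡ (∏.sum-cong-≋ {N′} λ j → factor≈a λ p →
        punchInᵢ≢i i₀ j (≡.trans (≡.sym (Inverse.strictlyInverseʳ e _)) (position-cong p))) ⟨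
      a * ∏.sum (removeAt (factor ∘ element) i₀)        ≈⟨ *-congˡ (*-identityˡ _) ⟨
      a * (1# * ∏.sum (removeAt (factor ∘ element) i₀)) ≈⟨ *-congˡ (*-congʳ (factor≈1 (element-position 0#))) ⟨
      a * (factor (element i₀) * ∏.sum (removeAt (factor ∘ element) i₀))
        ≈⟨ *-congˡ (∏.sum-remove (factor ∘ element)) ⟨
      a * ∏.sum (factor ∘ element)                      ≈⟨ *-congˡ ∏factor≈1 ⟩
      a * 1#                                            ≈⟨ *-identityʳ a ⟩
      a                                                 ∎
      where i₀ = position 0#

  ^-cardinality : ∀ {N′} → N ≡ suc N′ → ∀ x → x ^ N ≈ x
  ^-cardinality {N′} N≡ x with x ≈? 0#
  ... | no  x≉0 = nonZero-^cardinality x x≉0 N≡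
  ^-cardinality {N′} ≡.refl x | yes x≈0 = trans (trans (*-congʳ x≈0) (zeroˡ _)) (sym x≈0)

-- Characteristic two: Frobenius powers, trace sums and additive Hilbert 90.

HasCharacteristicTwo : ∀ {c ℓ} → CommutativeRing c ℓ → Set ℓ
HasCharacteristicTwo R = 1# + 1# ≈ 0#
  where open CommutativeRing R

module CharacteristicTwo {c ℓ} (R : CommutativeRing c ℓ) (1+1≈0 : HasCharacteristicTwo R) where
  open CommutativeRing R
  open CommutativeSemiringExp commutativeSemiring
  open MonoidSum +-monoid using (sum-syntax; sum-cong-≋)
  open MonicPolynomials commutativeSemiring using (Monic; Monic-resp-≈; Monic-^; Monic-+^)
  open SetoidReasoning setoid

  -- A ring solver with coefficients in 𝔽₂ (negation being the identity), so that
  -- identities valid only in characteristic two are decided by normalisation.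
  private
    ⟦_⟧₂ : Bool → Carrier
    ⟦ false ⟧₂ = 0#
    ⟦ true  ⟧₂ = 1#

    almostCommutativeRing : ACR.AlmostCommutativeRing c ℓ
    almostCommutativeRing = ACR.fromCommutativeSemiring commutativeSemiring

    𝔽₂⟶R : CommutativeRing.rawRing xor-∧-commutativeRing
             ACR.-Raw-AlmostCommutative⟶ almostCommutativeRing
    𝔽₂⟶R = record
      { ⟦_⟧    = ⟦_⟧₂
      ; +-homo = λ { false y → sym (+-identityˡ _) ; true false → sym (+-identityʳ _)
                   ; true true → sym 1+1≈0 }
      ; *-homo = λ { false y → sym (zeroˡ _) ; true y → sym (*-identityˡ _) }
      ; -‿homo = λ _ → refl
      ; 0-homo = refl
      ; 1-homo = refl
      }

    _coeff≟_ : ∀ x y → Maybe (⟦ x ⟧₂ ≈ ⟦ y ⟧₂)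
    false coeff≟ false = just refl
    true  coeff≟ true  = just refl
    _     coeff≟ _     = nothing

  open RingSolver (CommutativeRing.rawRing xor-∧-commutativeRing) almostCommutativeRing
    𝔽₂⟶R _coeff≟_ public using (solve; _:+_; _:*_; _:=_; con)

  x+y≈0⇒x≈y : ∀ {x y} → x + y ≈ 0# → x ≈ y
  x+y≈0⇒x≈y {x} {y} p = begin
    x           ≈⟨ solve 2 (λ x y → x := x :+ y :+ y) refl x y ⟩
    x + y + y   ≈⟨ +-congʳ p ⟩
    0# + y      ≈⟨ +-identityˡ y ⟩
    y           ∎

  Frob : ℕ → Carrier → Carrier
  Frob k x = x ^ (2 ℕ.^ k)

  Frob-cong : ∀ k {x y} → x ≈ y → Frob k x ≈ Frob k y
  Frob-cong k = ^-congˡ (2 ℕ.^ k)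

  Frob-* : ∀ k x y → Frob k (x * y) ≈ Frob k x * Frob k y
  Frob-* k x y = ^-distrib-* x y (2 ℕ.^ k)

  Frob-suc : ∀ k x → Frob (suc k) x ≈ Frob k x * Frob k x
  Frob-suc k x = trans (^-congʳ x (≡.cong (2 ℕ.^ k ℕ.+_) (ℕ.+-identityʳ _)))
    (^-homo-* x (2 ℕ.^ k) (2 ℕ.^ k))

  Frob-square : ∀ k x → Frob k (x * x) ≈ Frob (suc k) x
  Frob-square k x = trans (Frob-* k x x) (sym (Frob-suc k x))

  Frob-+ : ∀ k x y → Frob k (x + y) ≈ Frob k x + Frob k y
  -- `Frob 0 x` is `x ^ 1`, which unfolds to `x * 1#`; hence the factors `con true`.
  Frob-+ zero    x y = solve 2 (λ x y → (x :+ y) :* con true := x :* con true :+ y :* con true) refl x y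
  Frob-+ (suc k) x y = begin
    Frob (suc k) (x + y)                           ≈⟨ Frob-suc k _ ⟩
    Frob k (x + y) * Frob k (x + y)                ≈⟨ *-cong (Frob-+ k x y) (Frob-+ k x y) ⟩
    (Frob k x + Frob k y) * (Frob k x + Frob k y)  ≈⟨ solve 2 (λ u v → (u :+ v) :* (u :+ v)
                                                        := u :* u :+ v :* v) refl (Frob k x) (Frob k y) ⟩
    Frob k x * Frob k x + Frob k y * Frob k y      ≈⟨ +-cong (Frob-suc k x) (Frob-suc k y) ⟨
    Frob (suc k) x + Frob (suc k) y                ∎

  Frob-1 : ∀ k → Frob k 1# ≈ 1#
  Frob-1 zero    = *-identityʳ 1#
  Frob-1 (suc k) = trans (Frob-suc k 1#) (trans (*-cong (Frob-1 k) (Frob-1 k)) (*-identityˡ 1#))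

  Frob-∘ : ∀ j k x → Frob (j ℕ.+ k) x ≈ Frob k (Frob j x)
  Frob-∘ j k x = trans (^-congʳ x (ℕ.^-distribˡ-+-* 2 j k)) (sym (^-assocʳ x (2 ℕ.^ j) (2 ℕ.^ k)))

  -- The number of terms is a free parameter, independent of any field size, so that identities for
  -- partial traces can be proved by induction.
  trace : ℕ → Carrier → Carrier
  trace n x = ∑[ i < n ] (x ^ (2 ℕ.^ toℕ i))

  trace-cong : ∀ n {x y} → x ≈ y → trace n x ≈ trace n y
  trace-cong n x≈y = sum-cong-≋ {n} λ i → Frob-cong (toℕ i) x≈y

  trace-+ : ∀ n x y → trace n (x + y) ≈ trace n x + trace n y
  trace-+ n x y = trans (sum-cong-≋ {n} λ i → Frob-+ (toℕ i) x y)
    (CommutativeMonoidSum.∑-distrib-+ +-commutativeMonoid {n} _ _)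

  trace-unfold : ∀ n x → trace (suc n) x ≈ x + trace n (x * x)
  trace-unfold n x = +-cong (*-identityʳ x) (sum-cong-≋ {n} λ i → sym (Frob-square (toℕ i) x))

  trace-square : ∀ n x → trace n (x * x) ≈ trace n x * trace n x
  trace-square zero    x = sym (zeroˡ 0#)
  trace-square (suc n) x = begin
    trace (suc n) (x * x)                          ≈⟨ trace-unfold n _ ⟩
    x * x + trace n (x * x * (x * x))              ≈⟨ +-congˡ (trace-square n (x * x)) ⟩
    x * x + t * t                                  ≈⟨ solve 2 (λ x t → x :* x :+ t :* t
                                                        := (x :+ t) :* (x :+ t)) refl x t ⟩
    (x + t) * (x + t)                              ≈⟨ *-cong (trace-unfold n x) (trace-unfold n x) ⟨
    trace (suc n) x * trace (suc n) x              ∎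
    where t = trace n (x * x)

  trace-suc : ∀ n x → trace (suc n) x ≈ x + trace n x * trace n x
  trace-suc n x = trans (trace-unfold n x) (+-congˡ (trace-square n x))

  trace-snoc : ∀ n x → trace (suc n) x ≈ trace n x + Frob n x
  trace-snoc zero    x = +-comm _ _
  trace-snoc (suc n) x = begin
    trace (suc (suc n)) x                            ≈⟨ trace-suc (suc n) x ⟩
    x + trace (suc n) x * trace (suc n) x            ≈⟨ +-congˡ (*-cong (trace-snoc n x) (trace-snoc n x)) ⟩
    x + (t + f) * (t + f)                            ≈⟨ solve 3 (λ x t f → x :+ (t :+ f) :* (t :+ f)
                                                          := x :+ t :* t :+ f :* f) refl x t f ⟩
    x + t * t + f * f                                ≈⟨ +-cong (trace-suc n x) (Frob-suc n x) ⟨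
    trace (suc n) x + Frob (suc n) x                 ∎
    where t = trace n x ; f = Frob n x

  -- Every exponent in `trace n` is a power of two below 2ⁿ ≤ d, so the leading term survives.
  Monic-+trace : ∀ {d f} → Monic d f → ∀ n → 2 ℕ.^ n ℕ.≤ d → Monic d (λ x → f x + trace n x)
  Monic-+trace mf zero    _    = Monic-resp-≈ (λ x → sym (+-identityʳ _)) mf
  Monic-+trace mf (suc n) 2^≤d = Monic-resp-≈
    (λ x → trans (+-assoc _ _ _) (+-congˡ (sym (trace-snoc n x))))
    (Monic-+^ (Monic-+trace mf n (ℕ.<⇒≤ 2^n<d)) 2^n<d)
    where 2^n<d = ℕ.<-≤-trans (ℕ.^-monoʳ-< 2 (s≤s (s≤s z≤n)) (ℕ.n<1+n n)) 2^≤d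

  Monic-trace : ∀ n → Monic (2 ℕ.^ n) (trace (suc n))
  Monic-trace n = Monic-resp-≈ (λ x → trans (+-comm _ _) (sym (trace-snoc n x)))
    (Monic-+trace (Monic-^ (2 ℕ.^ n)) n ℕ.≤-refl)

  -- The explicit solution b of b² + b = x in additive Hilbert 90, where θ has trace 1.
  hilbert90 : Carrier → Carrier → ℕ → Carrier
  hilbert90 θ x zero    = 0#
  hilbert90 θ x (suc n) = hilbert90 θ x n + trace n x * Frob n θ

  -- Here b = ∑ sᵢ θ^(2ⁱ) over i < n, with sᵢ = `trace i x`. Squaring raises θ^(2ⁱ) to the next
  -- power, and sᵢ₊₁ = x + sᵢ², so b² + b telescopes. Both terms on the right are kept to make the
  -- induction work; they reduce to x once the trace of x is 0 and that of θ is 1.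
  hilbert90-equation : ∀ θ x n → let b = hilbert90 θ x n in
    b * b + b ≈ trace n x * Frob n θ + x * (trace n θ * trace n θ)
  hilbert90-equation θ x zero    = solve 2 (λ x f → con false :* con false :+ con false
    := con false :* f :+ x :* (con false :* con false)) refl x (Frob 0 θ)
  hilbert90-equation θ x (suc n) = begin
    (b + s * f) * (b + s * f) + (b + s * f)
      ≈⟨ solve 3 (λ b s f → (b :+ s :* f) :* (b :+ s :* f) :+ (b :+ s :* f)
           := (b :* b :+ b) :+ (s :* s :* (f :* f) :+ s :* f)) refl b s f ⟩
    (b * b + b) + (s * s * (f * f) + s * f)
      ≈⟨ +-congʳ (hilbert90-equation θ x n) ⟩
    (s * f + x * (t * t)) + (s * s * (f * f) + s * f)
      ≈⟨ solve 4 (λ x s f t → (s :* f :+ x :* (t :* t)) :+ (s :* s :* (f :* f) :+ s :* f)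
           := (x :+ s :* s) :* (f :* f) :+ x :* ((t :+ f) :* (t :+ f))) refl x s f t ⟩
    (x + s * s) * (f * f) + x * ((t + f) * (t + f))
      ≈⟨ +-cong (*-cong (trace-suc n x) (Frob-suc n θ))
                (*-congˡ (*-cong (trace-snoc n θ) (trace-snoc n θ))) ⟨
    trace (suc n) x * Frob (suc n) θ + x * (trace (suc n) θ * trace (suc n) θ) ∎
    where
    b = hilbert90 θ x n
    s = trace n x
    f = Frob n θ
    t = trace n θ

-- The absolute trace on the field with 2ⁿ elements, where n = m + 1.

module BinaryField {c ℓ} (K : Field c ℓ) (m : ℕ)
  (e : HasCardinality (Field.setoid K) (2 ℕ.^ suc m)) where

  open Field K
  open FieldProperties K
  open FiniteField K e
  open CommutativeSemiringExp commutativeSemiring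
  open SetoidReasoning setoid
  open CharacteristicTwo commutativeRing (2^n⋆1≈0⇒1+1≈0 (suc m) cardinality⋆1≈0) public

  private
    n = suc m

  Tr : Carrier → Carrier
  Tr = trace n

  H₀ : Pred Carrier ℓ
  H₀ x = Tr x ≈ 0#

  Frob-n : ∀ x → Frob n x ≈ x
  Frob-n = ^-cardinality (≡.sym (ℕ.suc-pred (2 ℕ.^ n) {{ℕ.m^n≢0 2 n}}))

  Frob-q*n : ∀ q x → Frob (q ℕ.* n) x ≈ x
  Frob-q*n zero    x = *-identityʳ x
  Frob-q*n (suc q) x = trans (Frob-∘ n (q ℕ.* n) x)
    (trans (Frob-q*n q (Frob n x)) (Frob-n x))

  sqrt : ∀ x → ∃[ y ] y * y ≈ x
  sqrt x = Frob m x , trans (sym (Frob-suc m x)) (Frob-n x)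

  -- The trace sum with one term too many is split at either end: the front leaves x + Tr(x²), the
  -- back leaves Tr(x) + x^(2ⁿ) = Tr(x) + x.
  Tr-square : ∀ x → Tr (x * x) ≈ Tr x
  Tr-square x = begin
    Tr (x * x)                   ≈⟨ solve 2 (λ x t → t := x :+ (x :+ t)) refl x (Tr (x * x)) ⟩
    x + (x + Tr (x * x))         ≈⟨ +-congˡ (trace-unfold n x) ⟨
    x + trace (suc n) x          ≈⟨ +-congˡ (trace-snoc n x) ⟩
    x + (Tr x + Frob n x)        ≈⟨ +-congˡ (+-congˡ (Frob-n x)) ⟩
    x + (Tr x + x)               ≈⟨ solve 2 (λ x t → x :+ (t :+ x) := t) refl x (Tr x) ⟩
    Tr x                         ∎

  x*x≈x⇒x≈1 : ∀ {x} → x * x ≈ x → ¬ (x ≈ 0#) → x ≈ 1#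
  x*x≈x⇒x≈1 {x} p x≉0 = *-cancelʳ-nonZero x≉0 (trans p (sym (*-identityˡ x)))

  -- Tr(x)² = Tr(x²) = Tr(x), and the only idempotents of a field are 0 and 1.
  Tr≉0⇒Tr≈1 : ∀ x → ¬ (Tr x ≈ 0#) → Tr x ≈ 1#
  Tr≉0⇒Tr≈1 x = x*x≈x⇒x≈1 (trans (sym (trace-square n x)) (Tr-square x))

  -- The trace is a polynomial of degree 2ᵐ < |K|, so it does not vanish identically.
  Tr-surjective : ∃[ θ ] Tr θ ≈ 1#
  Tr-surjective = Inverse.to e i , Tr≉0⇒Tr≈1 _ Tr≉0
    where
    to-injective : Injective _≡_ _≈_ (Inverse.to e)
    to-injective {i} {j} p = ≡.trans (≡.sym (Inverse.strictlyInverseʳ e i))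
      (≡.trans (Inverse.from-cong e p) (Inverse.strictlyInverseʳ e j))
    witness = ¬∀⟶∃¬ (2 ℕ.^ n) (λ i → Tr (Inverse.to e i) ≈ 0#) (λ i → Tr (Inverse.to e i) ≈? 0#)
      λ vanishes → ℕ.<⇒≱ (ℕ.^-monoʳ-< 2 (s≤s (s≤s z≤n)) (ℕ.n<1+n m))
        (roots≤degree (Monic-trace m) (Inverse.to e) to-injective vanishes)
    i = proj₁ witness
    Tr≉0 = proj₂ witness

  H₀⊆image : ∀ {x} → H₀ x → ∃[ b ] b * b + b ≈ x
  H₀⊆image {x} Trx≈0 = b , (begin
    b * b + b                                ≈⟨ hilbert90-equation θ x n ⟩
    Tr x * Frob n θ + x * (Tr θ * Tr θ)      ≈⟨ +-cong (*-congʳ Trx≈0) (*-congˡ (*-cong Trθ≈1 Trθ≈1)) ⟩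
    0# * Frob n θ + x * (1# * 1#)            ≈⟨ solve 2 (λ x f → con false :* f :+ x :* (con true :* con true)
                                                  := x) refl x (Frob n θ) ⟩
    x                                        ∎)
    where
    θ = proj₁ Tr-surjective
    Trθ≈1 = proj₂ Tr-surjective
    b = hilbert90 θ x n

  image⊆H₀ : ∀ b → H₀ (b * b + b)
  image⊆H₀ b = begin
    Tr (b * b + b)      ≈⟨ trace-+ n _ _ ⟩
    Tr (b * b) + Tr b   ≈⟨ +-congʳ (Tr-square b) ⟩
    Tr b + Tr b         ≈⟨ solve 1 (λ t → t :+ t := con false) refl (Tr b) ⟩
    0#                  ∎

  H₀-+ : ∀ {x y} → H₀ x → H₀ y → H₀ (x + y)
  H₀-+ {x} {y} p q = trans (trace-+ n x y) (trans (+-cong p q) (+-identityˡ 0#))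

  H₀-resp-≈ : H₀ Respects _≈_
  H₀-resp-≈ x≈y p = trans (trace-cong n (sym x≈y)) p

  -- Replacing Tr(a b) by Tr(a² b²) collects Tr(a(b² + b)) into Tr((a² + a) b²). As a is neither 0
  -- nor 1, a² + a is invertible, and b is chosen as the square root of θ / (a² + a) with Tr(θ) = 1.
  Tr∘a*-surjective-on-H₀ : ∀ a → ¬ (a ≈ 0#) → ¬ (a ≈ 1#) → ∃[ t ] H₀ t × Tr (a * t) ≈ 1#
  Tr∘a*-surjective-on-H₀ a a≉0 a≉1 = b * b + b , image⊆H₀ b , (begin
    Tr (a * (b * b + b))                         ≈⟨ trace-cong n (distribˡ a _ _) ⟩
    Tr (a * (b * b) + a * b)                     ≈⟨ trace-+ n _ _ ⟩
    Tr (a * (b * b)) + Tr (a * b)                ≈⟨ +-congˡ (Tr-square (a * b)) ⟨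
    Tr (a * (b * b)) + Tr (a * b * (a * b))      ≈⟨ trace-+ n _ _ ⟨
    Tr (a * (b * b) + a * b * (a * b))           ≈⟨ trace-cong n (solve 2 (λ a b →
                                                      a :* (b :* b) :+ a :* b :* (a :* b)
                                                      := a :* (a :+ con true) :* (b :* b)) refl a b) ⟩
    Tr (a * (a + 1#) * (b * b))                  ≈⟨ trace-cong n (*-congˡ (proj₂ (sqrt (w * θ)))) ⟩
    Tr (a * (a + 1#) * (w * θ))                  ≈⟨ trace-cong n (trans (sym (*-assoc _ w θ))
                                                      (trans (*-congʳ (proj₂ [a²+a]⁻¹)) (*-identityˡ θ))) ⟩
    Tr θ                                         ≈⟨ proj₂ Tr-surjective ⟩
    1#                                           ∎)
    where
    [a²+a]⁻¹ = inverse (a * (a + 1#)) (a≉1 ∘ x+y≈0⇒x≈y ∘ λ p → x*y≈0∧x≉0⇒y≈0 p a≉0)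
    w = proj₁ [a²+a]⁻¹
    θ = proj₁ Tr-surjective
    b = proj₁ (sqrt (w * θ))

  -- Halving an additively closed subset by a trace condition.

  module _ {p} {P : Pred Carrier p} (P? : Decidable P) (P-resp-≈ : P Respects _≈_)
    (P-+ : ∀ {x y} → P x → P y → P (x + y)) (a : Carrier)
    (t : Carrier) (Pt : P t) (Tr[at]≈1 : Tr (a * t) ≈ 1#) where
    private
      Q : Pred Carrier (p ⊔ ℓ)
      Q = P ∩ (λ x → Tr (a * x) ≈ 0#)

      shift : Fin 2 → Carrier → Carrier
      shift Fin.zero       x = x
      shift (Fin.suc _)    x = x + t

      shift-cong : ∀ i {x y} → x ≈ y → shift i x ≈ shift i y
      shift-cong Fin.zero    x≈y = x≈y
      shift-cong (Fin.suc _) x≈y = +-congʳ x≈y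

      P-shift : ∀ i {x} → P x → P (shift i x)
      P-shift Fin.zero    px = px
      P-shift (Fin.suc _) px = P-+ px Pt

      Tr-shift : ∀ x → Tr (a * (x + t)) ≈ Tr (a * x) + 1#
      Tr-shift x = trans (trace-cong n (distribˡ a x t)) (trans (trace-+ n _ _) (+-congˡ Tr[at]≈1))

      Tr≈0⇒Tr-shift≈1 : ∀ {x} → Tr (a * x) ≈ 0# → Tr (a * (x + t)) ≈ 1#
      Tr≈0⇒Tr-shift≈1 {x} p = trans (Tr-shift x) (trans (+-congʳ p) (+-identityˡ 1#))

      cosets-disjoint : ∀ {x y} → Tr (a * x) ≈ 0# → Tr (a * y) ≈ 0# → ¬ (x ≈ y + t)
      cosets-disjoint p q x≈y+t = 0≉1 (trans (sym p)
        (trans (trace-cong n (*-congˡ x≈y+t)) (Tr≈0⇒Tr-shift≈1 q)))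

      shift-injective : ∀ i j {x y} → Tr (a * x) ≈ 0# → Tr (a * y) ≈ 0# →
        shift i x ≈ shift j y → i ≡ j × x ≈ y
      shift-injective Fin.zero           Fin.zero           p q eq = ≡.refl , eq
      shift-injective Fin.zero           (Fin.suc _)        p q eq = ⊥-elim (cosets-disjoint p q eq)
      shift-injective (Fin.suc _)        Fin.zero           p q eq = ⊥-elim (cosets-disjoint q p (sym eq))
      shift-injective (Fin.suc Fin.zero) (Fin.suc Fin.zero) p q eq =
        ≡.refl , GroupProperties.∙-cancelʳ +-group t _ _ eq

      -- Adding t changes Tr(a x) by 1, so P is the disjoint union of Q and Q + t; `Fin 2` names the
      -- coset.
      cosets : Inverse (×-setoid (≡-setoid 2) (subsetSetoid setoid Q)) (subsetSetoid setoid P)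
      cosets = injection+section⇒inverse
        (record { to   = λ (i , x , px , _) → shift i x , P-shift i px
                ; cong = λ { {i , _} (≡.refl , x≈y) → shift-cong i x≈y } })
        (λ {(i , _ , _ , p)} {(j , _ , _ , q)} → shift-injective i j p q)
        section
        where
        section : ∀ y → ∃[ s ] shift (proj₁ s) (proj₁ (proj₂ s)) ≈ proj₁ y
        section (x , px) with Tr (a * x) ≈? 0#
        ... | yes Tr≈0 = (Fin.zero , x , px , Tr≈0) , refl
        ... | no  Tr≉0 = (Fin.suc Fin.zero , x + t , P-+ px Pt , Tr[a[x+t]]≈0)
                       , solve 2 (λ x t → x :+ t :+ t := x) refl x t
          where
          Tr[a[x+t]]≈0 : Tr (a * (x + t)) ≈ 0#
          Tr[a[x+t]]≈0 = trans (Tr-shift x) (trans (+-congʳ (Tr≉0⇒Tr≈1 _ Tr≉0))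
            (solve 0 (con true :+ con true := con false) refl))

    -- Q has some size M by decidability; the two cosets give 2M = 2N, and 2 cancels.
    HasCardinality-halve : ∀ {N} → HasCardinality (subsetSetoid setoid P) (2 ℕ.* N) →
      HasCardinality (subsetSetoid setoid Q) N
    HasCardinality-halve {N} eP with decidable-subset-finite e
        (λ x → P? x ×-dec (Tr (a * x) ≈? 0#))
        (λ x≈y (px , p) → P-resp-≈ x≈y px , trans (trace-cong n (*-congˡ (sym x≈y))) p)
    ... | M , eQ = ≡.subst (HasCardinality (subsetSetoid setoid Q))
      (ℕ.*-cancelˡ-≡ M N 2 (HasCardinality-unique
        (HasCardinality-respects cosets (HasCardinality-× (Identity.inverse (≡-setoid 2)) eQ)) eP)) eQ

  -- The whole field is halved with a = 1, the shift being an element of trace 1.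
  H₀-cardinality : HasCardinality (subsetSetoid setoid H₀) (2 ℕ.^ m)
  H₀-cardinality = HasCardinality-respects
    (subset-≐ ( (λ (_ , p) → trans (trace-cong n (sym (*-identityˡ _))) p)
              , (λ p → _ , trans (trace-cong n (*-identityˡ _)) p)))
    (HasCardinality-halve {P = U} (λ _ → yes _) _ _ 1# θ _
      (trans (trace-cong n (*-identityˡ θ)) Trθ≈1)
      (HasCardinality-respects (subset-U {S = setoid}) e))
    where
    θ = proj₁ Tr-surjective
    Trθ≈1 = proj₂ Tr-surjective

-- The Kasami power function and the set Δ.

kasami-exponent : ∀ k → 4 ℕ.^ k ℕ.∸ 2 ℕ.^ k ℕ.+ 1 ℕ.+ 2 ℕ.^ k ≡ 2 ℕ.^ (k ℕ.+ k) ℕ.+ 1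
kasami-exponent k = begin
  4 ℕ.^ k ℕ.∸ 2 ℕ.^ k ℕ.+ 1 ℕ.+ 2 ℕ.^ k   ≡⟨ ℕ.+-assoc _ 1 _ ⟩
  4 ℕ.^ k ℕ.∸ 2 ℕ.^ k ℕ.+ (1 ℕ.+ 2 ℕ.^ k) ≡⟨ ≡.cong (4 ℕ.^ k ℕ.∸ 2 ℕ.^ k ℕ.+_) (ℕ.+-comm 1 _) ⟩
  4 ℕ.^ k ℕ.∸ 2 ℕ.^ k ℕ.+ (2 ℕ.^ k ℕ.+ 1) ≡⟨ ℕ.+-assoc (4 ℕ.^ k ℕ.∸ 2 ℕ.^ k) _ 1 ⟨
  4 ℕ.^ k ℕ.∸ 2 ℕ.^ k ℕ.+ 2 ℕ.^ k ℕ.+ 1   ≡⟨ ≡.cong (ℕ._+ 1) (ℕ.m∸n+n≡m (ℕ.^-monoˡ-≤ k (s≤s (s≤s z≤n)))) ⟩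
  4 ℕ.^ k ℕ.+ 1                           ≡⟨ ≡.cong (ℕ._+ 1) (ℕ.^-*-assoc 2 2 k) ⟩
  2 ℕ.^ (2 ℕ.* k) ℕ.+ 1                   ≡⟨ ≡.cong (λ j → 2 ℕ.^ (k ℕ.+ j) ℕ.+ 1) (ℕ.+-identityʳ k) ⟩
  2 ℕ.^ (k ℕ.+ k) ℕ.+ 1                   ∎
  where open ≡.≡-Reasoning

module KasamiPower {c ℓ} (K : Field c ℓ) (m : ℕ)
  (e : HasCardinality (Field.setoid K) (2 ℕ.^ suc m)) (k : ℕ) where

  open Field K
  open FieldProperties K
  open FiniteField K e using (_≈?_)
  open BinaryField K m e
  open CommutativeSemiringExp commutativeSemiring
  open Kasami K (suc m) k using (F; δ; Δ; tripleSetoid; Solutions)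
  open SetoidReasoning setoid

  F-Frob : ∀ x → F x * Frob k x ≈ Frob k (Frob k x) * x
  F-Frob x = begin
    F x * Frob k x                            ≈⟨ ^-homo-* x (4 ℕ.^ k ℕ.∸ 2 ℕ.^ k ℕ.+ 1) (2 ℕ.^ k) ⟨
    x ^ (4 ℕ.^ k ℕ.∸ 2 ℕ.^ k ℕ.+ 1 ℕ.+ 2 ℕ.^ k)
                                              ≈⟨ ^-congʳ x (kasami-exponent k) ⟩
    x ^ (2 ℕ.^ (k ℕ.+ k) ℕ.+ 1)               ≈⟨ ^-homo-* x (2 ℕ.^ (k ℕ.+ k)) 1 ⟩
    Frob (k ℕ.+ k) x * x ^ 1                  ≈⟨ *-cong (Frob-∘ k k x) (*-identityʳ x) ⟩
    Frob k (Frob k x) * x                     ∎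

  F-zero : ∀ {x} → x ≈ 0# → F x ≈ 0#
  F-zero {x} x≈0 = trans (^-homo-* x (4 ℕ.^ k ℕ.∸ 2 ℕ.^ k) 1)
    (trans (*-congˡ (trans (*-identityʳ x) x≈0)) (zeroʳ _))

  -- Both congruence classes of k bring `F-Frob` to this shape, and w² cancels unless w = 0. In that
  -- case the first hypothesis forces x = 0, where both sides vanish.
  F≈cube : ∀ {x w} → (w ≈ 0# → x ≈ 0#) → F x * (w * w) ≈ w * (w * w * (w * w)) → F x ≈ w * w * w
  F≈cube {x} {w} w≈0⇒x≈0 Fxw²≈w⁵ with w ≈? 0#
  ... | yes w≈0 = trans (F-zero (w≈0⇒x≈0 w≈0)) (sym (trans (*-congʳ w²≈0) (zeroˡ w)))
    where
    w²≈0 : w * w ≈ 0#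
    w²≈0 = trans (*-congʳ w≈0) (zeroˡ w)
  ... | no  w≉0 = *-cancelʳ-nonZero (w≉0 ∘ λ p → x*y≈0∧x≉0⇒y≈0 p w≉0)
    (trans Fxw²≈w⁵ (solve 1 (λ w → w :* (w :* w :* (w :* w)) := w :* w :* w :* (w :* w)) refl w))

  -- If F is the cube of an additive bijection ψ fixing 1, then δ b = ψ(b)² + ψ(b).
  module _ (ψ : Carrier → Carrier) (ψ-+ : ∀ x y → ψ (x + y) ≈ ψ x + ψ y) (ψ-1 : ψ 1# ≈ 1#)
    (ψ-surjective : ∀ w → ∃[ b ] ψ b ≈ w) (F≈ψ³ : ∀ x → F x ≈ ψ x * ψ x * ψ x) where

    δ≈ψ²+ψ : ∀ b → δ b ≈ ψ b * ψ b + ψ b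
    δ≈ψ²+ψ b = begin
      F b + F (b + 1#) + 1#
        ≈⟨ +-congʳ (+-cong (F≈ψ³ b) (F≈ψ³ (b + 1#))) ⟩
      w * w * w + ψ (b + 1#) * ψ (b + 1#) * ψ (b + 1#) + 1#
        ≈⟨ +-congʳ (+-congˡ (*-cong (*-cong w+1 w+1) w+1)) ⟩
      w * w * w + (w + 1#) * (w + 1#) * (w + 1#) + 1#
        ≈⟨ solve 1 (λ w → w :* w :* w :+ (w :+ con true) :* (w :+ con true) :* (w :+ con true)
             :+ con true := w :* w :+ w) refl w ⟩
      w * w + w ∎
      where
      w = ψ b
      w+1 : ψ (b + 1#) ≈ w + 1#
      w+1 = trans (ψ-+ b 1#) (+-congˡ ψ-1)

    F≈ψ³⇒Δ≐H₀ : Δ ≐ H₀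
    F≈ψ³⇒Δ≐H₀ = (λ (b , x≈δb) → H₀-resp-≈ (sym (trans x≈δb (δ≈ψ²+ψ b))) (image⊆H₀ (ψ b)))
              , H₀⊆Δ
      where
      H₀⊆Δ : H₀ ⊆ Δ
      H₀⊆Δ p =
        let w , w²+w≈x = H₀⊆image p
            b , ψb≈w   = ψ-surjective w
        in b , sym (trans (δ≈ψ²+ψ b) (trans (+-cong (*-cong ψb≈w ψb≈w) ψb≈w) w²+w≈x))

  Frob-k≈square⇒Δ≐H₀ : (∀ x → Frob k x ≈ x * x) → Δ ≐ H₀
  Frob-k≈square⇒Δ≐H₀ Frob≈ = F≈ψ³⇒Δ≐H₀ (λ x → x) (λ _ _ → refl) refl (λ w → w , refl)
    (λ x → F≈cube (λ x≈0 → x≈0) (begin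
      F x * (x * x)                  ≈⟨ *-congˡ (Frob≈ x) ⟨
      F x * Frob k x                 ≈⟨ F-Frob x ⟩
      Frob k (Frob k x) * x          ≈⟨ *-comm _ x ⟩
      x * Frob k (Frob k x)          ≈⟨ *-congˡ (trans (Frob-cong k (Frob≈ x)) (Frob≈ (x * x))) ⟩
      x * (x * x * (x * x))          ∎))

  -- Here `Frob k` is the inverse of squaring. With w = ψ(x) this gives w² = x^(2ᵏ) and w⁴ = x, so
  -- `F-Frob` reads F(x) w² = w · w⁴.
  Frob-k+1≈id⇒Δ≐H₀ : (∀ x → Frob (suc k) x ≈ x) → Δ ≐ H₀
  Frob-k+1≈id⇒Δ≐H₀ Frob≈ = F≈ψ³⇒Δ≐H₀ (λ x → Frob k (Frob k x))
    (λ x y → trans (Frob-cong k (Frob-+ k x y)) (Frob-+ k _ _))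
    (trans (Frob-cong k (Frob-1 k)) (Frob-1 k))
    (λ w → w * w * (w * w) , (begin
      Frob k (Frob k (w * w * (w * w)))  ≈⟨ Frob-cong k (trans (Frob-square k (w * w)) (Frob≈ (w * w))) ⟩
      Frob k (w * w)                     ≈⟨ trans (Frob-square k w) (Frob≈ w) ⟩
      w                                  ∎))
    (λ x → F≈cube
      (λ w≈0 → trans (sym (fourth x)) (trans (*-congˡ (trans (*-congʳ w≈0) (zeroˡ _))) (zeroʳ _)))
      (trans (*-congˡ (square (Frob k x))) (trans (F-Frob x) (*-congˡ (sym (fourth x))))))
    where
    square : ∀ y → Frob k y * Frob k y ≈ y
    square y = trans (sym (Frob-suc k y)) (Frob≈ y)
    fourth : ∀ x → let w = Frob k (Frob k x) in w * w * (w * w) ≈ x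
    fourth x = trans (*-cong (square (Frob k x)) (square (Frob k x))) (square x)

  -- Counting the solutions.

  module _ (Δ≐H₀ : Δ ≐ H₀) {v₁ v₂ : Carrier} (v₁≉0 : ¬ (v₁ ≈ 0#)) where
    private
      w = proj₁ (inverse v₁ v₁≉0)

      v₁w≈1 : v₁ * w ≈ 1#
      v₁w≈1 = proj₂ (inverse v₁ v₁≉0)

      a = v₂ * w

      v₁a≈v₂ : v₁ * a ≈ v₂
      v₁a≈v₂ = trans (solve 3 (λ v w u → v :* (u :* w) := u :* (v :* w)) refl v₁ w v₂)
        (trans (*-congˡ v₁w≈1) (*-identityʳ v₂))

      H₁ : Pred Carrier ℓ
      H₁ = H₀ ∩ (λ x → Tr (a * x) ≈ 0#)

    -- The equation reads x + z = (v₂/v₁)(y + z), so a solution is determined by z and y + z.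
    solutions-parametrized :
      Inverse (×-setoid (subsetSetoid setoid H₀) (subsetSetoid setoid H₁))
              (subsetSetoid tripleSetoid (Solutions v₁ v₂))
    solutions-parametrized = injection+section⇒inverse
      (record
        { to = λ ((z , pz) , (u , pu , pau)) →
            (z + a * u , z + u , z) ,
            ((proj₂ Δ≐H₀ (H₀-+ pz pau) , proj₂ Δ≐H₀ (H₀-+ pz pu) , proj₂ Δ≐H₀ pz) ,
             solves z u)
        ; cong = λ (z≈ , u≈) → +-cong z≈ (*-congˡ u≈) , +-cong z≈ u≈ , z≈
        })
      (λ { {(z , _) , (u , _)} {(z′ , _) , (u′ , _)} (_ , z+u≈ , z≈) → z≈ ,
        GroupProperties.∙-cancelˡ +-group z u u′ (trans z+u≈ (+-congʳ (sym z≈))) })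
      λ ((x , y , z) , (dx , dy , dz) , eq) →
        let x+z≈a[y+z] = determines eq in
        ((z , proj₁ Δ≐H₀ dz) , (y + z , H₀-+ (proj₁ Δ≐H₀ dy) (proj₁ Δ≐H₀ dz) ,
          H₀-resp-≈ x+z≈a[y+z] (H₀-+ (proj₁ Δ≐H₀ dx) (proj₁ Δ≐H₀ dz)))) ,
        trans (+-congˡ (sym x+z≈a[y+z])) (solve 2 (λ x z → z :+ (x :+ z) := x) refl x z) ,
        solve 2 (λ y z → z :+ (y :+ z) := y) refl y z ,
        refl
      where
      solves : ∀ z u → v₁ * (z + a * u) + v₂ * (z + u) + (v₁ + v₂) * z ≈ 0#
      solves z u = begin
        v₁ * (z + a * u) + v₂ * (z + u) + (v₁ + v₂) * z
          ≈⟨ solve 5 (λ v₁ v₂ a z u → v₁ :* (z :+ a :* u) :+ v₂ :* (z :+ u) :+ (v₁ :+ v₂) :* z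
               := v₁ :* a :* u :+ v₂ :* u) refl v₁ v₂ a z u ⟩
        v₁ * a * u + v₂ * u
          ≈⟨ +-congʳ (*-congʳ v₁a≈v₂) ⟩
        v₂ * u + v₂ * u
          ≈⟨ solve 1 (λ x → x :+ x := con false) refl (v₂ * u) ⟩
        0# ∎

      determines : ∀ {x y z} → v₁ * x + v₂ * y + (v₁ + v₂) * z ≈ 0# → x + z ≈ a * (y + z)
      determines {x} {y} {z} eq = *-cancelʳ-nonZero v₁≉0 (x+y≈0⇒x≈y (begin
        (x + z) * v₁ + a * (y + z) * v₁
          ≈⟨ solve 5 (λ v₁ a x y z → (x :+ z) :* v₁ :+ a :* (y :+ z) :* v₁
               := v₁ :* x :+ v₁ :* z :+ v₁ :* a :* (y :+ z)) refl v₁ a x y z ⟩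
        v₁ * x + v₁ * z + v₁ * a * (y + z)
          ≈⟨ +-congˡ (*-congʳ v₁a≈v₂) ⟩
        v₁ * x + v₁ * z + v₂ * (y + z)
          ≈⟨ solve 5 (λ v₁ v₂ x y z → v₁ :* x :+ v₁ :* z :+ v₂ :* (y :+ z)
               := v₁ :* x :+ v₂ :* y :+ (v₁ :+ v₂) :* z) refl v₁ v₂ x y z ⟩
        v₁ * x + v₂ * y + (v₁ + v₂) * z
          ≈⟨ eq ⟩
        0# ∎))

    -- This is where n ≥ 2 enters: with m = m′ + 1, H₀ has even size 2^(m′+1) and can be halved once
    -- more, giving 2^(m′+1) choices of z and 2^m′ of u.
    solutions-cardinality : ∀ {m′} → m ≡ suc m′ → ¬ (v₂ ≈ 0#) → ¬ (v₁ ≈ v₂) →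
      HasCardinality (subsetSetoid tripleSetoid (Solutions v₁ v₂)) (2 ℕ.^ (suc m′ ℕ.+ m′))
    solutions-cardinality {m′} ≡.refl v₂≉0 v₁≉v₂ =
      ≡.subst (HasCardinality _) (≡.sym (ℕ.^-distribˡ-+-* 2 (suc m′) m′))
        (HasCardinality-respects solutions-parametrized
          (HasCardinality-× H₀-cardinality
            (HasCardinality-halve (λ x → Tr x ≈? 0#) H₀-resp-≈ H₀-+ a
              (proj₁ t) (proj₁ (proj₂ t)) (proj₂ (proj₂ t)) H₀-cardinality)))
      where
      -- The ratio a = v₂/v₁ is not 0 because v₂ is nonzero, and not 1 because v₁ and v₂ differ.
      t = Tr∘a*-surjective-on-H₀ a
        (λ a≈0 → v₂≉0 (trans (sym v₁a≈v₂) (trans (*-congˡ a≈0) (zeroʳ v₁))))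
        (λ a≈1 → v₁≉v₂ (trans (sym (*-identityʳ v₁)) (trans (*-congˡ (sym a≈1)) v₁a≈v₂)))

theorem7p1 : ∀ {c ℓ} (n : ℕ) (K : Field c ℓ) → HasCardinality (Field.setoid K) (2 ℕ.^ n) →
    2 ℕ.≤ n → (k : ℕ) → 1 ℕ.≤ k → gcd k n ≡ 1 →
    (+ k ≡ 1ℤ [mod n ]) ⊎ (+ k ≡ -1ℤ [mod n ]) →
    let open Field K
        open Kasami K n k
    in (Δ ≐ H₀) ×
       ((v₁ v₂ : Carrier) → ¬ (v₁ ≈ 0#) → ¬ (v₂ ≈ 0#) → ¬ (v₁ ≈ v₂) →
        HasCardinality (subsetSetoid tripleSetoid (Solutions v₁ v₂)) (2 ℕ.^ (2 ℕ.* n ℕ.∸ 3)))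
theorem7p1 (suc (suc m)) K e (s≤s (s≤s z≤n)) (suc k) (s≤s z≤n) _ k≡±1 =
  Δ≐H₀ k≡±1 , λ v₁ v₂ v₁≉0 v₂≉0 v₁≉v₂ →
    ≡.subst (HasCardinality _) (≡.cong (2 ℕ.^_) (≡.sym exponent))
      (solutions-cardinality (Δ≐H₀ k≡±1) v₁≉0 ≡.refl v₂≉0 v₁≉v₂)
  where
  open Field K
  open BinaryField K (suc m) e
  open KasamiPower K (suc m) e (suc k)
  n = suc (suc m)

  exponent : 2 ℕ.* n ℕ.∸ 3 ≡ suc m ℕ.+ m
  exponent = ≡.cong (ℕ._∸ 1) (≡.trans (ℕ.+-suc m _)
    (≡.cong suc (≡.trans (ℕ.+-suc m _) (≡.cong (suc ∘ (m ℕ.+_)) (ℕ.+-identityʳ m)))))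

  Δ≐H₀ : (+ suc k ≡ 1ℤ [mod n ]) ⊎ (+ suc k ≡ -1ℤ [mod n ]) → Kasami.Δ K n (suc k) ≐ H₀
  -- The exponent is `suc k`, so n divides k: `Frob k` is the identity and one squaring remains.
  Δ≐H₀ (inj₁ (divides q k≡q*n)) = Frob-k≈square⇒Δ≐H₀ λ x →
    trans (Frob-suc k x) (*-cong (Frob-k x) (Frob-k x))
    where
    Frob-k : ∀ x → Frob k x ≈ x
    Frob-k x = trans (reflexive (≡.cong (λ j → Frob j x) k≡q*n)) (Frob-q*n q x)
  -- Subtracting -1 adds 1, so n divides `suc k + 1` and one further squaring after `Frob (suc k)`
  -- returns to the identity.
  Δ≐H₀ (inj₂ (divides q k+1≡q*n)) = Frob-k+1≈id⇒Δ≐H₀ λ x →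
    trans (reflexive (≡.cong (λ j → Frob j x) (≡.trans (ℕ.+-comm 1 (suc k)) k+1≡q*n)))
      (Frob-q*n q x)
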